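{- For any parameter $d>1$, every deterministic algorithm that solves the $d$-approximate $1$-region problem must make at least $\log\log n-\log\log(d+1)$ adaptive queries to the sorted input list $X[1,n]$ (in the worst case).
   Context: Logarithms are base $2$. The input is a list $X[1,n]$ whose entries are in $\{0,1\}$, sorted in nondecreasing order; the algorithm accesses it only by adaptive queries, each revealing one entry $X[i]$. A $d$-approximate $1$-region is an interval $R=[s,n]$ (containing the last position $n$) such that at least $\frac{|R|}{d}$ of the numbers in $X[s,n]$ equal $1$, and $[s,n]$ contains all positions $j$ with $X[j]=1$; here $|R|$ is the number of integers in $R$. -}

module Defs where

import Algebra.Definitions.RawSemiring as RawSemiring
open import Data.Fin.Base as Fin using (Fin)
import Data.Fin.Properties as Fin
open import Data.Integer.Base as ℤ using (ℤ; +_; -[1+_])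
open import Data.List.Base using (List; length; filter; allFin)
open import Data.Nat.Base using (ℕ; suc)
open import Data.Product.Base using (_×_; ∃; ∃₂)
open import Data.Rational.Base as ℚ using (ℚ; 0ℚ; ½; ↥_; ↧ₙ_)
open import Data.Sum.Base using (_⊎_)
open import Data.Vec.Functional using (Vector)
open import Function.Bundles using (_⇔_)
open import Relation.Binary.PropositionalEquality using (_≡_)
open import Relation.Nullary using (¬_)

open RawSemiring ℚ.+-*-rawSemiring using (_^_)

------------------------------------------------------------------------
-- Real numbers as Dedekind cuts

-- The operations act on arbitrary pairs of predicates on ℚ, to be read
-- as  lower x r = "r < x"  and  upper x r = "x < r".  The laws of a cut
-- are kept apart, in IsReal, so that log 0 = -∞ is a Cut as well: its
-- lower part is empty and its upper part is everything.
record Cut : Set₁ where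
  field
    lower : ℚ → Set
    upper : ℚ → Set

open Cut public

record IsReal (x : Cut) : Set where
  field
    lower-inhabited : ∃ (lower x)
    upper-inhabited : ∃ (upper x)
    lower-rounded   : ∀ q → lower x q ⇔ (∃ λ r → q ℚ.< r × lower x r)
    upper-rounded   : ∀ r → upper x r ⇔ (∃ λ q → q ℚ.< r × upper x q)
    disjoint        : ∀ q → ¬ (lower x q × upper x q)
    located         : ∀ {q r} → q ℚ.< r → lower x q ⊎ upper x r

infix 4 _<_ _≤_
infix  8 -_
infixl 7 _÷_
infixl 6 _+_ _-_

_<_ : Cut → Cut → Set
x < y = ∃ λ r → upper x r × lower y r

_≤_ : Cut → Cut → Set
x ≤ y = ¬ (y < x)

fromℚ : ℚ → Cut
fromℚ q = record { lower = ℚ._< q ; upper = q ℚ.<_ }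

fromℕ : ℕ → Cut
fromℕ n = fromℚ (+ n ℚ./ 1)

_+_ : Cut → Cut → Cut
x + y = record
  { lower = λ r → ∃₂ λ a b → lower x a × lower y b × r ≡ a ℚ.+ b
  ; upper = λ r → ∃₂ λ a b → upper x a × upper y b × r ≡ a ℚ.+ b
  }

-_ : Cut → Cut
- x = record
  { lower = λ r → upper x (ℚ.- r)
  ; upper = λ r → lower x (ℚ.- r)
  }

_-_ : Cut → Cut → Cut
x - y = x + (- y)

-- The quotient m / y, for a positive real y: r < m / y iff r * t < m for
-- some rational t > y, and m / y < r iff m < r * t for some rational
-- 0 < t < y.
_÷_ : ℕ → Cut → Cut
m ÷ y = record
  { lower = λ r → ∃ λ t → 0ℚ ℚ.< t × upper y t × r ℚ.* t ℚ.< + m ℚ./ 1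
  ; upper = λ r → ∃ λ t → 0ℚ ℚ.< t × lower y t × + m ℚ./ 1 ℚ.< r ℚ.* t
  }

2^_ : ℤ → ℚ
2^ (+ n)    = (+ 2 ℚ./ 1) ^ n
2^ -[1+ n ] = ½ ^ suc n

-- The binary logarithm.  For r = p / q in lowest terms and a rational
-- t > 0, 2 to the power r is below t iff 2^p < t^q; hence r < log x iff
-- 2^p < t^q for some rational 0 < t < x, and dually for the upper part.
-- If x ≤ 0 this gives log x = -∞.
log : Cut → Cut
log x = record
  { lower = λ r → ∃ λ t → 0ℚ ℚ.< t × lower x t × 2^ (↥ r) ℚ.< t ^ (↧ₙ r)
  ; upper = λ r → ∃ λ t → 0ℚ ℚ.< t × upper x t × t ^ (↧ₙ r) ℚ.< 2^ (↥ r)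
  }

------------------------------------------------------------------------
-- Approximate 1-regions

-- A list X[1,n] with entries in {0,1}; position j is the index j - 1.
Input : ℕ → Set
Input n = Vector (Fin 2) n

pattern 𝟙 = Fin.suc Fin.zero

Sorted : ∀ {n} → Input n → Set
Sorted X = ∀ i j → i Fin.≤ j → X i Fin.≤ X j

-- The interval [s,n].
interval : ∀ {n} → Fin n → List (Fin n)
interval {n} s = filter (s Fin.≤?_) (allFin n)

-- The number of 1s in X[s,n].
ones : ∀ {n} → Input n → Fin n → ℕ
ones X s = length (filter (λ j → X j Fin.≟ 𝟙) (interval s))

record Is1Region {n} (d : Cut) (X : Input n) (s : Fin n) : Set where
  field
    dense    : length (interval s) ÷ d ≤ fromℕ (ones X s)
    complete : ∀ j → X j ≡ 𝟙 → s Fin.≤ j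

-- A list without any 1 has no d-approximate 1-region, since an interval
-- containing position n is nonempty.
IsInstance : ∀ {n} → Cut → Input n → Set
IsInstance d X = Sorted X × ∃ (Is1Region d X)

------------------------------------------------------------------------
-- Deterministic adaptive query algorithms on lists of length n, as
-- decision trees; the answer s stands for the interval [s,n].

data Algorithm (n : ℕ) : Set where
  answer : Fin n → Algorithm n
  query  : Fin n → (Fin 2 → Algorithm n) → Algorithm n

run : ∀ {n} → Algorithm n → Input n → Fin n
run (answer s)  X = s
run (query i k) X = run (k (X i)) X

queries : ∀ {n} → Algorithm n → Input n → ℕ
queries (answer s)  X = 0
queries (query i k) X = suc (queries (k (X i)) X)

Solves : ∀ {n} → Cut → Algorithm n → Set
Solves d A = ∀ X → IsInstance d X → Is1Region d X (run A X)

{-# OPTIONS --safe #-}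

-- Only the inputs "1 from position j on" are needed.  If one answer s is
-- correct for all such j in [p,e], then n - p + 1 ≤ (d + 1) (n - e), since
-- s ≤ p and n - s ≤ d (n - e), counting positions from 0.  A query splits the
-- range of the possible j in two, so with T queries the factor d + 1 becomes
-- at most (d + 1)^(2^T); for the full range this gives n < (d + 1)^(2^T), and
-- two logarithms give the bound.  Rational upper bounds of d and of the
-- logarithms replace the reals throughout.
module Submission where

open import Defs
open import Algebra.Bundles using (CommutativeRing)
open import Data.Fin.Base as Fin using (Fin; toℕ)
import Data.Fin.Properties as Fin
open import Data.Integer.Base as ℤ using (ℤ; +_; -[1+_])
import Data.Integer.Properties as ℤ
open import Data.Integer.Tactic.RingSolver using (solve-∀)
open import Data.List.Base using ([]; _∷_; length; filter; allFin; map; tabulate)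
open import Data.List.Extrema.Nat using (argmax; f[xs]≤f[argmax])
import Data.List.Membership.Propositional.Properties as List
import Data.List.Properties as List
import Data.List.Relation.Binary.Sublist.Propositional.Properties as Sublist
import Data.List.Relation.Unary.All as All
import Data.List.Relation.Unary.All.Properties as All
open import Data.Nat.Base as ℕ using (ℕ; zero; suc; _∸_)
import Data.Nat.Properties as ℕ
open import Data.Product.Base using (_×_; ∃; _,_; proj₁; proj₂)
open import Data.Rational.Base as ℚ
  using (ℚ; mkℚ; 0ℚ; 1ℚ; ½; ↥_; ↧ₙ_; toℚᵘ; nonNegative; positive)
import Data.Rational.Properties as ℚ
open import Data.Rational.Unnormalised.Base as ℚᵘ using (mkℚᵘ)
import Data.Rational.Unnormalised.Properties as ℚᵘ
open import Data.Sum.Base using (inj₁; inj₂)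
open import Function.Base using (_∘_)
open import Function.Bundles using (Equivalence)
open import Level using (0ℓ)
open import Relation.Binary.Definitions using (tri<; tri≈; tri>)
open import Relation.Binary.PropositionalEquality
  using (_≡_; refl; sym; trans; cong; cong₂; subst; module ≡-Reasoning)
open import Relation.Nullary using (yes; no; contradiction)
open import Relation.Unary using (Pred; Decidable)
open import Algebra.Properties.CommutativeSemiring.Exp
  (CommutativeRing.commutativeSemiring ℚ.+-*-commutativeRing)

-- Order and powers of rationals

0≤* : ∀ {x y} → 0ℚ ℚ.≤ x → 0ℚ ℚ.≤ y → 0ℚ ℚ.≤ x ℚ.* y
0≤* {x} {y} 0≤x 0≤y = ℚ.nonNegative⁻¹ (x ℚ.* y)
  {{ℚ.nonNeg*nonNeg⇒nonNeg x {{nonNegative 0≤x}} y {{nonNegative 0≤y}}}}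

*-mono-≤ : ∀ {x y z w} → 0ℚ ℚ.≤ x → 0ℚ ℚ.≤ w → x ℚ.≤ y → z ℚ.≤ w → x ℚ.* z ℚ.≤ y ℚ.* w
*-mono-≤ {x} {w = w} 0≤x 0≤w x≤y z≤w = ℚ.≤-trans
  (ℚ.*-monoˡ-≤-nonNeg x {{nonNegative 0≤x}} z≤w)
  (ℚ.*-monoʳ-≤-nonNeg w {{nonNegative 0≤w}} x≤y)

0≤^ : ∀ {x} n → 0ℚ ℚ.≤ x → 0ℚ ℚ.≤ x ^ n
0≤^ zero    0≤x = ℚ.nonNegative⁻¹ 1ℚ
0≤^ (suc n) 0≤x = 0≤* 0≤x (0≤^ n 0≤x)

^-monoˡ-≤ : ∀ {x y} n → 0ℚ ℚ.≤ x → x ℚ.≤ y → x ^ n ℚ.≤ y ^ n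
^-monoˡ-≤ zero    0≤x x≤y = ℚ.≤-refl
^-monoˡ-≤ (suc n) 0≤x x≤y =
  *-mono-≤ 0≤x (0≤^ n (ℚ.≤-trans 0≤x x≤y)) x≤y (^-monoˡ-≤ n 0≤x x≤y)

1≤^ : ∀ {x} n → 1ℚ ℚ.≤ x → 1ℚ ℚ.≤ x ^ n
1≤^ zero    1≤x = ℚ.≤-refl
1≤^ (suc n) 1≤x = *-mono-≤ {1ℚ} {z = 1ℚ} (ℚ.nonNegative⁻¹ 1ℚ)
  (ℚ.≤-trans (ℚ.nonNegative⁻¹ 1ℚ) (1≤^ n 1≤x)) 1≤x (1≤^ n 1≤x)

x≤y*x : ∀ {x y} → 0ℚ ℚ.≤ x → 1ℚ ℚ.≤ y → x ℚ.≤ y ℚ.* x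
x≤y*x {x} {y} 0≤x 1≤y = subst (ℚ._≤ y ℚ.* x) (ℚ.*-identityˡ x)
  (ℚ.*-monoʳ-≤-nonNeg x {{nonNegative 0≤x}} 1≤y)

-- Integer powers of 2 and comparison of logarithms

2ℚ : ℚ
2ℚ = + 2 ℚ./ 1

2^-suc : ∀ i → 2^ (ℤ.suc i) ≡ 2ℚ ℚ.* 2^ i
2^-suc (+ n)        = refl
2^-suc -[1+ zero ]  = refl
2^-suc -[1+ suc n ] = begin
  -- `2ℚ * ½` evaluates to `1ℚ`, so inserting it in front is definitional.
  ½ ^ suc n                  ≡⟨ ℚ.*-identityˡ _ ⟨
  2ℚ ℚ.* ½ ℚ.* ½ ^ suc n     ≡⟨ ℚ.*-assoc 2ℚ ½ (½ ^ suc n) ⟩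
  2ℚ ℚ.* (½ ℚ.* ½ ^ suc n)   ∎
  where open ≡-Reasoning

2^-homo-+ : ∀ i n → 2^ (i ℤ.+ + n) ≡ 2^ (+ n) ℚ.* 2^ i
2^-homo-+ i zero    = trans (cong 2^_ (ℤ.+-identityʳ i)) (sym (ℚ.*-identityˡ (2^ i)))
2^-homo-+ i (suc n) = begin
  2^ (i ℤ.+ + suc n)           ≡⟨ cong 2^_ (i+suc i (+ n)) ⟩
  2^ (ℤ.suc (i ℤ.+ + n))       ≡⟨ 2^-suc (i ℤ.+ + n) ⟩
  2ℚ ℚ.* 2^ (i ℤ.+ + n)        ≡⟨ cong (2ℚ ℚ.*_) (2^-homo-+ i n) ⟩
  2ℚ ℚ.* (2^ (+ n) ℚ.* 2^ i)   ≡⟨ ℚ.*-assoc 2ℚ (2^ (+ n)) (2^ i) ⟨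
  2^ (+ suc n) ℚ.* 2^ i        ∎
  where
  open ≡-Reasoning
  i+suc : ∀ i j → i ℤ.+ (+ 1 ℤ.+ j) ≡ + 1 ℤ.+ (i ℤ.+ j)
  i+suc = solve-∀

2^-assocʳ : ∀ i n → (2^ i) ^ n ≡ 2^ (i ℤ.* + n)
2^-assocʳ (+ m)    n       = trans (^-assocʳ 2ℚ m n) (cong 2^_ (ℤ.pos-* m n))
2^-assocʳ -[1+ m ] zero    = cong 2^_ (sym (ℤ.*-zeroʳ -[1+ m ]))
2^-assocʳ -[1+ m ] (suc n) = ^-assocʳ ½ (suc m) (suc n)

0<2^ : ∀ i → 0ℚ ℚ.< 2^ i
0<2^ (+ n)    = 0<^ n
  where
  0<^ : ∀ n → 0ℚ ℚ.< 2ℚ ^ n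
  0<^ zero    = ℚ.positive⁻¹ 1ℚ
  0<^ (suc n) = ℚ.*-monoʳ-<-pos 2ℚ (0<^ n)
0<2^ -[1+ n ] = 0<^ (suc n)
  where
  0<^ : ∀ n → 0ℚ ℚ.< ½ ^ n
  0<^ zero    = ℚ.positive⁻¹ 1ℚ
  0<^ (suc n) = ℚ.*-monoʳ-<-pos ½ (0<^ n)

0≤2^ : ∀ i → 0ℚ ℚ.≤ 2^ i
0≤2^ i = ℚ.<⇒≤ (0<2^ i)

1≤2ℚ : 1ℚ ℚ.≤ 2ℚ
1≤2ℚ = ℚ.*≤* (ℤ.+≤+ (ℕ.s≤s ℕ.z≤n))

2^-mono-≤ : ∀ {i j} → i ℤ.≤ j → 2^ i ℚ.≤ 2^ j
2^-mono-≤ {i} {j} i≤j = subst (λ k → 2^ i ℚ.≤ 2^ k) i+n≡j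
  (subst (2^ i ℚ.≤_) (sym (2^-homo-+ i n)) (x≤y*x (0≤2^ i) (1≤^ n 1≤2ℚ)))
  where
  n = ℤ.∣ j ℤ.- i ∣
  i+j-i : ∀ i j → i ℤ.+ (j ℤ.- i) ≡ j
  i+j-i = solve-∀
  i+n≡j : i ℤ.+ + n ≡ j
  i+n≡j = trans (cong (λ k → i ℤ.+ k) (ℤ.0≤i⇒+∣i∣≡i (ℤ.i≤j⇒0≤j-i i≤j))) (i+j-i i j)

2^-cancel-≤ : ∀ {i j} → 2^ i ℚ.≤ 2^ j → i ℤ.≤ j
2^-cancel-≤ {i} {j} 2^i≤2^j with i ℤ.≤? j
... | yes i≤j = i≤j
... | no  i≰j = contradiction refl (ℚ.<⇒≢ (begin-strict
  2^ j             ≡⟨ ℚ.*-identityˡ (2^ j) ⟨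
  1ℚ ℚ.* 2^ j      <⟨ ℚ.*-monoˡ-<-pos (2^ j) {{ℚ.positive (0<2^ j)}} 1<2 ⟩
  2ℚ ℚ.* 2^ j      ≡⟨ 2^-suc j ⟨
  2^ (ℤ.suc j)     ≤⟨ 2^-mono-≤ (ℤ.i<j⇒suc[i]≤j (ℤ.≰⇒> i≰j)) ⟩
  2^ i             ≤⟨ 2^i≤2^j ⟩
  2^ j             ∎))
  where
  open ℚ.≤-Reasoning
  1<2 : 1ℚ ℚ.< 2ℚ
  1<2 = ℚ.*<* (ℤ.+<+ (ℕ.s≤s (ℕ.s≤s ℕ.z≤n)))

nat : ℕ → ℚ
nat n = + n ℚ./ 1

toℚᵘ-nat : ∀ n → toℚᵘ (nat n) ℚᵘ.≃ mkℚᵘ (+ n) 0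
toℚᵘ-nat n = ℚ.toℚᵘ-fromℚᵘ (mkℚᵘ (+ n) 0)

-- Here log x < r and s < log y in the encoding of log; the conclusion reflects
-- log y ≤ M log x + T.
log-mono : ∀ {x y r s} M T → 0ℚ ℚ.< x → 0ℚ ℚ.< y →
           x ^ (↧ₙ r) ℚ.< 2^ (↥ r) → 2^ (↥ s) ℚ.< y ^ (↧ₙ s) →
           y ℚ.≤ x ^ M ℚ.* 2^ (+ T) → s ℚ.≤ nat M ℚ.* r ℚ.+ nat T
log-mono {x} {y} {r@(mkℚ p a _)} {s@(mkℚ p′ b _)} M T 0<x 0<y x<2^r 2^s<y y≤ =
  -- In unnormalised fractions numerators and denominators compute, so the claim becomes an
  -- inequality of integers.
  ℚ.toℚᵘ-cancel-≤ (ℚᵘ.≤-respʳ-≃ (ℚᵘ.≃-sym split) (ℚᵘ.*≤* cross))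
  where
  q  = suc a
  q′ = suc b
  0≤x = ℚ.<⇒≤ 0<x

  exponents : M ℕ.* (q′ ℕ.* q) ≡ q ℕ.* (M ℕ.* q′)
  exponents = trans (sym (ℕ.*-assoc M q′ q)) (ℕ.*-comm (M ℕ.* q′) q)

  -- Raising to the power `q′ * q` clears the denominators of `s` and `r` together; only integer
  -- exponents of 2 remain to be compared.
  powers : 2^ (p′ ℤ.* + q) ℚ.≤ 2^ (p ℤ.* + (M ℕ.* q′) ℤ.+ + (T ℕ.* (q′ ℕ.* q)))
  powers = begin
    2^ (p′ ℤ.* + q)          ≡⟨ 2^-assocʳ p′ q ⟨
    (2^ p′) ^ q              ≤⟨ ^-monoˡ-≤ q (0≤2^ p′) (ℚ.<⇒≤ 2^s<y) ⟩
    (y ^ q′) ^ q             ≡⟨ ^-assocʳ y q′ q ⟩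
    y ^ (q′ ℕ.* q)           ≤⟨ ^-monoˡ-≤ (q′ ℕ.* q) (ℚ.<⇒≤ 0<y) y≤ ⟩
    (x ^ M ℚ.* 2^ (+ T)) ^ (q′ ℕ.* q)
      ≡⟨ ^-distrib-* (x ^ M) (2^ (+ T)) (q′ ℕ.* q) ⟩
    (x ^ M) ^ (q′ ℕ.* q) ℚ.* (2^ (+ T)) ^ (q′ ℕ.* q)
      ≡⟨ cong₂ ℚ._*_ (^-assocʳ x M (q′ ℕ.* q)) (^-assocʳ 2ℚ T (q′ ℕ.* q)) ⟩
    x ^ (M ℕ.* (q′ ℕ.* q)) ℚ.* 2^ (+ (T ℕ.* (q′ ℕ.* q)))
      ≡⟨ cong (λ e → x ^ e ℚ.* 2^ (+ (T ℕ.* (q′ ℕ.* q)))) exponents ⟩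
    x ^ (q ℕ.* (M ℕ.* q′)) ℚ.* 2^ (+ (T ℕ.* (q′ ℕ.* q)))
      ≡⟨ cong (ℚ._* 2^ (+ (T ℕ.* (q′ ℕ.* q)))) (^-assocʳ x q (M ℕ.* q′)) ⟨
    (x ^ q) ^ (M ℕ.* q′) ℚ.* 2^ (+ (T ℕ.* (q′ ℕ.* q)))
      ≤⟨ ℚ.*-monoʳ-≤-nonNeg _ {{nonNegative (0≤2^ (+ (T ℕ.* (q′ ℕ.* q))))}}
           (^-monoˡ-≤ (M ℕ.* q′) (0≤^ q 0≤x) (ℚ.<⇒≤ x<2^r)) ⟩
    (2^ p) ^ (M ℕ.* q′) ℚ.* 2^ (+ (T ℕ.* (q′ ℕ.* q)))
      ≡⟨ cong (ℚ._* 2^ (+ (T ℕ.* (q′ ℕ.* q)))) (2^-assocʳ p (M ℕ.* q′)) ⟩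
    2^ (p ℤ.* + (M ℕ.* q′)) ℚ.* 2^ (+ (T ℕ.* (q′ ℕ.* q)))
      ≡⟨ ℚ.*-comm (2^ (p ℤ.* + (M ℕ.* q′))) _ ⟩
    2^ (+ (T ℕ.* (q′ ℕ.* q))) ℚ.* 2^ (p ℤ.* + (M ℕ.* q′))
      ≡⟨ 2^-homo-+ (p ℤ.* + (M ℕ.* q′)) (T ℕ.* (q′ ℕ.* q)) ⟨
    2^ (p ℤ.* + (M ℕ.* q′) ℤ.+ + (T ℕ.* (q′ ℕ.* q)))   ∎
    where open ℚ.≤-Reasoning

  bound = mkℚᵘ (+ M) 0 ℚᵘ.* mkℚᵘ p a ℚᵘ.+ mkℚᵘ (+ T) 0

  split : toℚᵘ (nat M ℚ.* r ℚ.+ nat T) ℚᵘ.≃ bound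
  split = ℚᵘ.≃-trans (ℚ.toℚᵘ-homo-+ (nat M ℚ.* r) (nat T)) (ℚᵘ.+-cong
    (ℚᵘ.≃-trans (ℚ.toℚᵘ-homo-* (nat M) r) (ℚᵘ.*-cong (toℚᵘ-nat M) (ℚᵘ.≃-refl {mkℚᵘ p a})))
    (toℚᵘ-nat T))

  lhs : ∀ p′ q → p′ ℤ.* (+ 1 ℤ.* q ℤ.* + 1) ≡ p′ ℤ.* q
  lhs = solve-∀

  rhs : ∀ M T p q q′ → (M ℤ.* p ℤ.* + 1 ℤ.+ T ℤ.* (+ 1 ℤ.* q)) ℤ.* q′ ≡
                       p ℤ.* (M ℤ.* q′) ℤ.+ T ℤ.* (q′ ℤ.* q)
  rhs = solve-∀

  cross : p′ ℤ.* (+ 1 ℤ.* + q ℤ.* + 1) ℤ.≤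
          (+ M ℤ.* p ℤ.* + 1 ℤ.+ + T ℤ.* (+ 1 ℤ.* + q)) ℤ.* + q′
  cross = begin
    p′ ℤ.* (+ 1 ℤ.* + q ℤ.* + 1)                        ≡⟨ lhs p′ (+ q) ⟩
    p′ ℤ.* + q                                          ≤⟨ 2^-cancel-≤ powers ⟩
    p ℤ.* + (M ℕ.* q′) ℤ.+ + (T ℕ.* (q′ ℕ.* q))
      ≡⟨ cong₂ (λ i j → p ℤ.* i ℤ.+ j) (ℤ.pos-* M q′) (ℤ.pos-* T (q′ ℕ.* q)) ⟩
    p ℤ.* (+ M ℤ.* + q′) ℤ.+ + T ℤ.* (+ q′ ℤ.* + q)     ≡⟨ rhs (+ M) (+ T) p (+ q) (+ q′) ⟨
    (+ M ℤ.* p ℤ.* + 1 ℤ.+ + T ℤ.* (+ 1 ℤ.* + q)) ℤ.* + q′ ∎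
    where open ℤ.≤-Reasoning

-- Naturals as rationals

nat-mono-≤ : ∀ {m n} → m ℕ.≤ n → nat m ℚ.≤ nat n
nat-mono-≤ {m} {n} m≤n = ℚ.toℚᵘ-cancel-≤ (begin
  toℚᵘ (nat m)  ≃⟨ toℚᵘ-nat m ⟩
  mkℚᵘ (+ m) 0  ≤⟨ ℚᵘ.*≤* (ℤ.*-monoʳ-≤-nonNeg (+ 1) (ℤ.+≤+ m≤n)) ⟩
  mkℚᵘ (+ n) 0  ≃⟨ toℚᵘ-nat n ⟨
  toℚᵘ (nat n)  ∎)
  where open ℚᵘ.≤-Reasoning

0≤nat : ∀ n → 0ℚ ℚ.≤ nat n
0≤nat n = nat-mono-≤ {0} {n} ℕ.z≤n

nat-homo-+ : ∀ m n → nat (m ℕ.+ n) ≡ nat m ℚ.+ nat n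
nat-homo-+ m n = ℚ.toℚᵘ-injective (begin-equality
  toℚᵘ (nat (m ℕ.+ n))               ≃⟨ toℚᵘ-nat (m ℕ.+ n) ⟩
  mkℚᵘ (+ (m ℕ.+ n)) 0               ≃⟨ ℚᵘ.*≡* (clear (+ m) (+ n)) ⟩
  mkℚᵘ (+ m) 0 ℚᵘ.+ mkℚᵘ (+ n) 0     ≃⟨ ℚᵘ.+-cong (toℚᵘ-nat m) (toℚᵘ-nat n) ⟨
  toℚᵘ (nat m) ℚᵘ.+ toℚᵘ (nat n)     ≃⟨ ℚ.toℚᵘ-homo-+ (nat m) (nat n) ⟨
  toℚᵘ (nat m ℚ.+ nat n)             ∎)
  where
  open ℚᵘ.≤-Reasoning
  clear : ∀ i j → (i ℤ.+ j) ℤ.* + 1 ≡ (i ℤ.* + 1 ℤ.+ j ℤ.* + 1) ℤ.* + 1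
  clear = solve-∀

nat-2^ : ∀ n → nat (2 ℕ.^ n) ≡ 2^ (+ n)
nat-2^ zero    = refl
nat-2^ (suc n) = begin
  nat (2 ℕ.^ suc n)                    ≡⟨ cong (λ m → nat (2 ℕ.^ n ℕ.+ m)) (ℕ.+-identityʳ (2 ℕ.^ n)) ⟩
  nat (2 ℕ.^ n ℕ.+ 2 ℕ.^ n)            ≡⟨ nat-homo-+ (2 ℕ.^ n) (2 ℕ.^ n) ⟩
  nat (2 ℕ.^ n) ℚ.+ nat (2 ℕ.^ n)      ≡⟨ cong (λ x → x ℚ.+ x) (nat-2^ n) ⟩
  2^ (+ n) ℚ.+ 2^ (+ n)                ≡⟨ cong (λ x → x ℚ.+ x) (ℚ.*-identityˡ (2^ (+ n))) ⟨
  1ℚ ℚ.* 2^ (+ n) ℚ.+ 1ℚ ℚ.* 2^ (+ n)  ≡⟨ ℚ.*-distribʳ-+ (2^ (+ n)) 1ℚ 1ℚ ⟨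
  2^ (+ suc n)                         ∎
  where open ≡-Reasoning

-- Cuts and quotients

lower<upper : ∀ {x} → IsReal x → ∀ {q r} → lower x q → upper x r → q ℚ.< r
lower<upper x-real {q} {r} q<x x<r with ℚ.<-cmp q r
... | tri< q<r _ _  = q<r
... | tri≈ _ refl _ = contradiction (q<x , x<r) (disjoint q)
  where open IsReal x-real
-- The upper part is closed upwards, so `q` would lie on both sides of the cut.
... | tri> _ _ r<q  = contradiction (q<x , Equivalence.from (upper-rounded q) (r , r<q , x<r)) (disjoint q)
  where open IsReal x-real

-- If `nat b * t` were below `nat a`, a rational `m` strictly between them would give `m / t`, which
-- lies above `b` and, by the witness `t`, below `a ÷ d`.
÷≤⇒≤* : ∀ a b {d t} → a ÷ d ≤ fromℕ b → 0ℚ ℚ.< t → upper d t → nat a ℚ.≤ nat b ℚ.* t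
÷≤⇒≤* a b {d} {t} a÷d≤b 0<t d<t = ℚ.≮⇒≥ λ bt<a →
  let m , bt<m , m<a = ℚ.<-dense bt<a
      rt≡m = trans (ℚ.*-assoc m (ℚ.1/ t) t)
        (trans (cong (m ℚ.*_) (ℚ.*-inverseˡ t)) (ℚ.*-identityʳ m))
  in a÷d≤b ( m ℚ.* ℚ.1/ t
           , ℚ.*-cancelʳ-<-nonNeg t (subst (nat b ℚ.* t ℚ.<_) (sym rt≡m) bt<m)
           , t , 0<t , d<t , subst (ℚ._< nat a) (sym rt≡m) m<a )
  where instance
    t-pos : ℚ.Positive t
    t-pos = positive 0<t
    t-nonZero : ℚ.NonZero t
    t-nonZero = ℚ.pos⇒nonZero t
    t-nonNeg : ℚ.NonNegative t
    t-nonNeg = ℚ.pos⇒nonNeg t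

-- This is the density of an interval filled with 1s; it holds because every rational above `d`
-- exceeds 1.
n÷d≤n : ∀ {d} → IsReal d → fromℕ 1 < d → ∀ n → n ÷ d ≤ fromℕ n
n÷d≤n d-real (q , 1<q , q<d) n (r , n<r , t , 0<t , d<t , rt<n) =
  ℚ.<-irrefl refl (begin-strict
    r           ≡⟨ ℚ.*-identityʳ r ⟨
    r ℚ.* 1ℚ    ≤⟨ ℚ.*-monoˡ-≤-nonNeg r {{nonNegative (ℚ.<⇒≤ (ℚ.≤-<-trans (0≤nat n) n<r))}}
                     (ℚ.<⇒≤ (ℚ.<-trans 1<q (lower<upper d-real q<d d<t))) ⟩
    r ℚ.* t     <⟨ rt<n ⟩
    nat n       <⟨ n<r ⟩
    r           ∎)
  where open ℚ.≤-Reasoning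

-- Lengths of intervals and numbers of 1s

length-filter-map : ∀ {A B : Set} {P : Pred B 0ℓ} (P? : Decidable P) (f : A → B) xs →
                    length (filter P? (map f xs)) ≡ length (filter (P? ∘ f) xs)
length-filter-map P? f []       = refl
length-filter-map P? f (x ∷ xs) with P? (f x)
... | yes _ = cong suc (length-filter-map P? f xs)
... | no  _ = length-filter-map P? f xs

length-interval : ∀ {n} (s : Fin n) → length (interval s) ≡ n ∸ toℕ s
length-interval {suc n} Fin.zero = trans
  (cong length (List.filter-all (Fin.zero {n} Fin.≤?_) (All.universal (λ _ → ℕ.z≤n) (allFin (suc n)))))
  (List.length-tabulate {n = suc n} (λ i → i))
length-interval {suc n} (Fin.suc s) = begin
  -- Position zero fails the test by computation, so only the tail is left.
  length (filter (Fin.suc s Fin.≤?_) (tabulate {n = n} Fin.suc))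
    ≡⟨ cong (length ∘ filter (Fin.suc s Fin.≤?_)) (List.map-tabulate {n = n} (λ i → i) Fin.suc) ⟨
  length (filter (Fin.suc s Fin.≤?_) (map Fin.suc (allFin n)))
    ≡⟨ length-filter-map (Fin.suc s Fin.≤?_) Fin.suc (allFin n) ⟩
  length (filter ((Fin.suc s Fin.≤?_) ∘ Fin.suc) (allFin n))
    ≡⟨ cong length (List.filter-≐ _ (s Fin.≤?_) ((λ { (ℕ.s≤s s≤i) → s≤i }) , ℕ.s≤s) (allFin n)) ⟩
  length (interval s)
    ≡⟨ length-interval s ⟩
  n ∸ toℕ s ∎
  where open ≡-Reasoning

-- Both sides filter `allFin n`, and an index that passes the two tests on the left passes the one
-- on the right.
ones≤ : ∀ {n} (X : Input n) (j s : Fin n) → (∀ i → X i ≡ 𝟙 → j Fin.≤ i) →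
        ones X s ℕ.≤ length (interval j)
ones≤ {n} X j s 𝟙⇒≥j = Sublist.length-mono-≤
  (Sublist.filter⁺ (λ i → X i Fin.≟ 𝟙) (j Fin.≤?_) (λ { {i} refl → 𝟙⇒≥j i })
    (Sublist.filter-⊆ (s Fin.≤?_) (allFin n)))

-- Threshold inputs

threshold : ∀ {n} → ℕ → Input n
threshold j i with j ℕ.≤? toℕ i
... | yes _ = 𝟙
... | no  _ = Fin.zero

threshold-≥ : ∀ {n j} {i : Fin n} → j ℕ.≤ toℕ i → threshold j i ≡ 𝟙
threshold-≥ {j = j} {i} j≤i with j ℕ.≤? toℕ i
... | yes _   = refl
... | no  j≰i = contradiction j≤i j≰i

threshold-< : ∀ {n j} {i : Fin n} → toℕ i ℕ.< j → threshold j i ≡ Fin.zero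
threshold-< {j = j} {i} i<j with j ℕ.≤? toℕ i
... | yes j≤i = contradiction j≤i (ℕ.<⇒≱ i<j)
... | no  _   = refl

threshold-complete : ∀ {n j} {i : Fin n} → threshold j i ≡ 𝟙 → j ℕ.≤ toℕ i
threshold-complete {j = j} {i} eq with j ℕ.≤? toℕ i
... | yes j≤i = j≤i

threshold-sorted : ∀ {n} j → Sorted {n} (threshold j)
threshold-sorted j i i′ i≤i′ with j ℕ.≤? toℕ i
... | yes j≤i = ℕ.≤-reflexive (cong toℕ (sym (threshold-≥ {j = j} (ℕ.≤-trans j≤i i≤i′))))
... | no  _   = ℕ.z≤n

-- The region starting at `j` is the witness: all its entries are 1, so `n÷d≤n` gives its density.
threshold-isInstance : ∀ {n d} → IsReal d → fromℕ 1 < d → (j : Fin n) →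
                       IsInstance d (threshold (toℕ j))
threshold-isInstance {n} {d} d-real 1<d j = threshold-sorted (toℕ j) , j , record
  { dense    = subst (λ m → length (interval j) ÷ d ≤ fromℕ m) (sym ones≡length)
                 (n÷d≤n d-real 1<d (length (interval j)))
  ; complete = λ _ → threshold-complete
  }
  where
  ones≡length : ones (threshold (toℕ j)) j ≡ length (interval j)
  ones≡length = cong length (List.filter-all _
    (All.map (λ {i} → threshold-≥ {j = toℕ j}) (All.all-filter (j Fin.≤?_) (allFin n))))

-- The adversary argument

-- Good s j means that s is an acceptable answer on threshold j, and w is a
-- potential that a single answer can change by a factor of at most u.  The
-- thresholds in [p,e) are those not yet excluded, and a query splits this
-- range in two; both parts are solved with one query less.
adversary : ∀ {n} (Good : Fin n → ℕ → Set) (w : ℕ → ℚ) (u : ℚ) →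
            1ℚ ℚ.≤ u → (∀ e → 0ℚ ℚ.≤ w e) →
            (∀ {s p e} → Good s p → Good s e → w p ℚ.≤ u ℚ.* w (suc e)) →
            ∀ A T {p e} → p ℕ.≤ e →
            (∀ {j} → p ℕ.≤ j → j ℕ.< e →
              queries A (threshold j) ℕ.≤ T × Good (run A (threshold j)) j) →
            w p ℚ.≤ u ^ (2 ℕ.^ T) ℚ.* w e
adversary {n} Good w u 1≤u 0≤w common = go
  where
  open ℚ.≤-Reasoning

  go : ∀ A T {p e} → p ℕ.≤ e →
       (∀ {j} → p ℕ.≤ j → j ℕ.< e →
         queries A (threshold j) ℕ.≤ T × Good (run A (threshold j)) j) →
       w p ℚ.≤ u ^ (2 ℕ.^ T) ℚ.* w e
  go A T {p} p≤e H with ℕ.m≤n⇒m<n∨m≡n p≤e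
  -- The range is empty; the factor is at least 1.
  go A           T {p}     p≤e H | inj₂ refl = x≤y*x (0≤w p) (1≤^ (2 ℕ.^ T) 1≤u)
  -- The same `s` is correct for the first threshold `p` and for the last one, which is `e` since
  -- the end `suc e` is excluded.
  go (answer s)  T {p} {suc e} p≤e H | inj₁ p<1+e = begin
    w p                            ≤⟨ common (proj₂ (H ℕ.≤-refl p<1+e)) (proj₂ (H p≤e′ ℕ.≤-refl)) ⟩
    u ℚ.* w (suc e)                ≤⟨ ℚ.*-monoʳ-≤-nonNeg (w (suc e)) {{nonNegative (0≤w (suc e))}} u≤ ⟩
    u ^ (2 ℕ.^ T) ℚ.* w (suc e)    ∎
    where
    p≤e′ = ℕ.s≤s⁻¹ p<1+e
    u≤ : u ℚ.≤ u ^ (2 ℕ.^ T)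
    -- Exposing the positive exponent as a successor splits off one factor `u`.
    u≤ with 2 ℕ.^ T | ℕ.m^n>0 2 T
    ... | suc m | _ = subst (u ℚ.≤_) (ℚ.*-comm (u ^ m) u)
      (x≤y*x (ℚ.≤-trans (ℚ.nonNegative⁻¹ 1ℚ) 1≤u) (1≤^ m 1≤u))
  go (query i k) zero    p≤e H | inj₁ p<e = contradiction (proj₁ (H ℕ.≤-refl p<e)) λ ()
  -- Answer 1 at `i` leaves the thresholds up to `i`, answer 0 the later ones. Chaining the two
  -- bounds at `m` squares the factor and so doubles the exponent.
  go (query i k) (suc T) {p} {e} p≤e H | inj₁ p<e = begin
    w p                                               ≤⟨ go (k 𝟙) T p≤m below ⟩
    u ^ (2 ℕ.^ T) ℚ.* w m
      ≤⟨ ℚ.*-monoˡ-≤-nonNeg (u ^ (2 ℕ.^ T)) {{nonNegative 0≤u^}} (go (k Fin.zero) T m≤e above) ⟩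
    u ^ (2 ℕ.^ T) ℚ.* (u ^ (2 ℕ.^ T) ℚ.* w e)
      ≡⟨ ℚ.*-assoc (u ^ (2 ℕ.^ T)) (u ^ (2 ℕ.^ T)) (w e) ⟨
    u ^ (2 ℕ.^ T) ℚ.* u ^ (2 ℕ.^ T) ℚ.* w e
      ≡⟨ cong (ℚ._* w e) (^-homo-* u (2 ℕ.^ T) (2 ℕ.^ T)) ⟨
    u ^ (2 ℕ.^ T ℕ.+ 2 ℕ.^ T) ℚ.* w e
      ≡⟨ cong (λ m → u ^ (2 ℕ.^ T ℕ.+ m) ℚ.* w e) (ℕ.+-identityʳ (2 ℕ.^ T)) ⟨
    u ^ (2 ℕ.^ suc T) ℚ.* w e                         ∎
    where
    0≤u^ = ℚ.≤-trans (ℚ.nonNegative⁻¹ 1ℚ) (1≤^ (2 ℕ.^ T) 1≤u)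
    -- The split point suc i, clamped to [p,e].
    m = p ℕ.⊔ (suc (toℕ i) ℕ.⊓ e)
    p≤m : p ℕ.≤ m
    p≤m = ℕ.m≤m⊔n p _
    m≤e : m ℕ.≤ e
    m≤e = ℕ.⊔-lub p≤e (ℕ.m⊓n≤n _ e)
    answered : ∀ {j x} → threshold j i ≡ x → p ℕ.≤ j → j ℕ.< e →
               queries (k x) (threshold j) ℕ.≤ T × Good (run (k x) (threshold j)) j
    answered {j} refl p≤j j<e = let q , g = H p≤j j<e in ℕ.s≤s⁻¹ q , g
    below : ∀ {j} → p ℕ.≤ j → j ℕ.< m →
            queries (k 𝟙) (threshold j) ℕ.≤ T × Good (run (k 𝟙) (threshold j)) j
    below {j} p≤j j<m = answered (threshold-≥ j≤i) p≤j (ℕ.<-≤-trans j<m m≤e)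
      where
      j≤i : j ℕ.≤ toℕ i
      -- Otherwise both arguments of the maximum `m` would be at most `j`.
      j≤i = ℕ.≮⇒≥ λ i<j → ℕ.<⇒≱ j<m (ℕ.⊔-lub p≤j (ℕ.≤-trans (ℕ.m⊓n≤m _ e) i<j))
    above : ∀ {j} → m ℕ.≤ j → j ℕ.< e →
            queries (k Fin.zero) (threshold j) ℕ.≤ T × Good (run (k Fin.zero) (threshold j)) j
    above {j} m≤j j<e = answered (threshold-< i<j) (ℕ.≤-trans p≤m m≤j) j<e
      where
      i<j : toℕ i ℕ.< j
      -- Otherwise `j` would be below both `suc (toℕ i)` and `e`, hence below `m`.
      i<j = ℕ.≰⇒> λ j≤i → ℕ.<⇒≱ (ℕ.⊓-pres-m< (ℕ.s≤s j≤i) j<e) (ℕ.≤-trans (ℕ.m≤n⊔m p _) m≤j)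

-- The length of the list against the number of queries

length-bound : ∀ {n d} (A : Algorithm n) → IsReal d → fromℕ 1 < d → Solves d A →
               ∀ {t u} T → upper d t → 1ℚ ℚ.+ t ℚ.≤ u →
               (∀ (j : Fin n) → queries A (threshold (toℕ j)) ℕ.≤ T) →
               nat n ℚ.≤ u ^ (2 ℕ.^ T)
length-bound {n} {d} A d-real 1<d solves {t} {u} T d<t 1+t≤u queries≤T = begin
  nat n                       ≤⟨ nat-mono-≤ (ℕ.n≤1+n n) ⟩
  -- For `e ≤ n` the potential is one more than the number of positions from `e` on, so that it ends
  -- at 1 and not at 0.
  nat (suc n)                 ≤⟨ adversary Good (λ e → nat (suc n ∸ e)) u 1≤u
                                   (λ e → 0≤nat (suc n ∸ e)) common A T ℕ.z≤n correct ⟩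
  u ^ (2 ℕ.^ T) ℚ.* nat (suc n ∸ n)   ≡⟨ cong (λ m → u ^ (2 ℕ.^ T) ℚ.* nat m) (ℕ.m+n∸n≡m 1 n) ⟩
  u ^ (2 ℕ.^ T) ℚ.* 1ℚ        ≡⟨ ℚ.*-identityʳ (u ^ (2 ℕ.^ T)) ⟩
  u ^ (2 ℕ.^ T)               ∎
  where
  open ℚ.≤-Reasoning
  0<t : 0ℚ ℚ.< t
  0<t = let q , 1<q , q<d = 1<d in
    ℚ.<-trans (ℚ.positive⁻¹ 1ℚ) (ℚ.<-trans 1<q (lower<upper d-real q<d d<t))
  1≤u : 1ℚ ℚ.≤ u
  1≤u = ℚ.≤-trans (ℚ.+-monoʳ-≤ 1ℚ (ℚ.<⇒≤ 0<t)) 1+t≤u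

  -- What correctness on `threshold j` yields once `d` is replaced by a rational `t` above it:
  -- `n ∸ toℕ s` is the length of the answer and `n ∸ j` bounds its number of 1s.
  Good : Fin n → ℕ → Set
  Good s j = toℕ s ℕ.≤ j × j ℕ.< n × nat (n ∸ toℕ s) ℚ.≤ nat (n ∸ j) ℚ.* t

  common : ∀ {s p e} → Good s p → Good s e →
           nat (suc n ∸ p) ℚ.≤ u ℚ.* nat (n ∸ e)
  common {s} {p} {e} (s≤p , p<n , _) (_ , e<n , dense) = begin
    nat (suc n ∸ p)             ≡⟨ cong nat (ℕ.+-∸-assoc 1 (ℕ.<⇒≤ p<n)) ⟩
    nat (suc (n ∸ p))           ≡⟨ nat-homo-+ 1 (n ∸ p) ⟩
    -- The summand 1 is absorbed by `b`, which is at least 1 as `e < n`; the other summand is at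
    -- most the length of the common answer, as `s` starts no later than `p`.
    1ℚ ℚ.+ nat (n ∸ p)          ≤⟨ ℚ.+-mono-≤ (nat-mono-≤ (ℕ.m<n⇒0<n∸m e<n))
                                     (ℚ.≤-trans (nat-mono-≤ (ℕ.∸-monoʳ-≤ n s≤p)) dense) ⟩
    b ℚ.+ b ℚ.* t               ≡⟨ cong₂ ℚ._+_ (sym (ℚ.*-identityˡ b)) (ℚ.*-comm b t) ⟩
    1ℚ ℚ.* b ℚ.+ t ℚ.* b        ≡⟨ ℚ.*-distribʳ-+ b 1ℚ t ⟨
    (1ℚ ℚ.+ t) ℚ.* b            ≤⟨ ℚ.*-monoʳ-≤-nonNeg b {{nonNegative (0≤nat (n ∸ e))}} 1+t≤u ⟩
    u ℚ.* b                     ∎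
    where b = nat (n ∸ e)

  correct : ∀ {j} → 0 ℕ.≤ j → j ℕ.< n →
            queries A (threshold j) ℕ.≤ T × Good (run A (threshold j)) j
  correct _ j<n with Fin.fromℕ< j<n | Fin.toℕ-fromℕ< j<n
  ... | j | refl = queries≤T j , complete j (threshold-≥ {j = toℕ j} ℕ.≤-refl) , j<n , (begin
    nat (n ∸ toℕ s)                   ≡⟨ cong nat (length-interval s) ⟨
    nat (length (interval s))         ≤⟨ ÷≤⇒≤* (length (interval s)) (ones X s) {d} dense 0<t d<t ⟩
    nat (ones X s) ℚ.* t              ≤⟨ ℚ.*-monoʳ-≤-nonNeg t {{nonNegative (ℚ.<⇒≤ 0<t)}}
                                           (nat-mono-≤ (ones≤ X j s λ _ → threshold-complete)) ⟩
    nat (length (interval j)) ℚ.* t   ≡⟨ cong (λ m → nat m ℚ.* t) (length-interval j) ⟩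
    nat (n ∸ toℕ j) ℚ.* t             ∎)
    where
    X = threshold (toℕ j)
    s = run A X
    open Is1Region (solves X (threshold-isInstance d-real 1<d j))

-- Taking two logarithms

loglog-bound : ∀ {d} n T → (∀ {t u} → upper d t → 1ℚ ℚ.+ t ℚ.≤ u → nat n ℚ.≤ u ^ (2 ℕ.^ T)) →
               log (log (fromℕ n)) - log (log (d + fromℕ 1)) ≤ fromℕ T
loglog-bound n T n≤
  -- A violation unpacks into rationals: `w < n` with `v < log w` and `a < log v`, and
  -- `x + y > d + 1` with `log (x + y) < t` and `log t < - b`.
  ( _ , T<a+b , a , b
  , (v , 0<v , (w , 0<w , w<n , 2^v<w) , 2^a<v)
  , (t , 0<t , (_ , 0<u , (x , y , d<x , 1<y , refl) , u<2^t) , t<2^-b)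
  , refl ) = ℚ.<-irrefl refl (begin-strict
    nat T                              <⟨ T<a+b ⟩
    a ℚ.+ b                            ≤⟨ ℚ.+-monoˡ-≤ b a≤ ⟩
    1ℚ ℚ.* ℚ.- b ℚ.+ nat T ℚ.+ b       ≡⟨ cong (λ c → c ℚ.+ nat T ℚ.+ b) (ℚ.*-identityˡ (ℚ.- b)) ⟩
    ℚ.- b ℚ.+ nat T ℚ.+ b              ≡⟨ cong (ℚ._+ b) (ℚ.+-comm (ℚ.- b) (nat T)) ⟩
    nat T ℚ.- b ℚ.+ b                  ≡⟨ ℚ.+-assoc (nat T) (ℚ.- b) b ⟩
    nat T ℚ.+ (ℚ.- b ℚ.+ b)            ≡⟨ cong (nat T ℚ.+_) (ℚ.+-inverseˡ b) ⟩
    nat T ℚ.+ 0ℚ                       ≡⟨ ℚ.+-identityʳ (nat T) ⟩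
    nat T                              ∎)
  where
  open ℚ.≤-Reasoning
  M = 2 ℕ.^ T
  w≤ : w ℚ.≤ (x ℚ.+ y) ^ M ℚ.* 1ℚ
  w≤ = begin
    w                        ≤⟨ ℚ.<⇒≤ w<n ⟩
    nat n                    ≤⟨ n≤ d<x (subst (ℚ._≤ x ℚ.+ y) (ℚ.+-comm x 1ℚ) (ℚ.+-monoʳ-≤ x (ℚ.<⇒≤ 1<y))) ⟩
    (x ℚ.+ y) ^ M            ≡⟨ ℚ.*-identityʳ ((x ℚ.+ y) ^ M) ⟨
    (x ℚ.+ y) ^ M ℚ.* 1ℚ     ∎
  v≤ : v ℚ.≤ t ^ 1 ℚ.* 2^ (+ T)
  v≤ = begin
    -- The first logarithm turns the exponent `M` into a factor; there is no power of 2 yet, hence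
    -- the 0.
    v                        ≤⟨ log-mono M 0 0<u 0<w u<2^t 2^v<w w≤ ⟩
    nat M ℚ.* t ℚ.+ 0ℚ       ≡⟨ ℚ.+-identityʳ (nat M ℚ.* t) ⟩
    nat M ℚ.* t              ≡⟨ ℚ.*-comm (nat M) t ⟩
    t ℚ.* nat M              ≡⟨ cong₂ ℚ._*_ (sym (ℚ.*-identityʳ t)) (nat-2^ T) ⟩
    t ^ 1 ℚ.* 2^ (+ T)       ∎
  a≤ : a ℚ.≤ 1ℚ ℚ.* ℚ.- b ℚ.+ nat T
  -- The second logarithm turns the factor `M`, which is the power of 2 with exponent `T`, into the
  -- summand `T`.
  a≤ = log-mono {r = ℚ.- b} 1 T 0<t 0<v t<2^-b 2^a<v v≤

theorem3 : (d : Cut) → IsReal d → fromℕ 1 < d →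
    (n : ℕ) (A : Algorithm n) → Solves d A →
    ∃ λ (X : Input n) → IsInstance d X ×
    log (log (fromℕ n)) - log (log (d + fromℕ 1)) ≤ fromℕ (queries A X)
theorem3 d d-real 1<d n A solves =
  -- The adversary needs one bound for all thresholds, so a threshold of maximal cost is exhibited.
  threshold (toℕ worst) , threshold-isInstance d-real 1<d worst ,
  loglog-bound {d} n (cost worst) λ d<t 1+t≤u →
    length-bound A d-real 1<d solves (cost worst) d<t 1+t≤u λ j →
      All.lookup (f[xs]≤f[argmax] j₀ (allFin n)) (List.∈-allFin j)
  where
  -- Fin n is inhabited because A has an answer.
  j₀ = run A (threshold 0)
  cost : Fin n → ℕ
  cost j = queries A (threshold (toℕ j))
  worst = argmax cost j₀ (allFin n)
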